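{- Let $\vec d=(\vec a,\vec b)$ be a bidegree sequence of length $n$ with the entries of $\vec a$ in non-increasing order and $\sum_{i=1}^n a_i=\sum_{i=1}^n b_i=n\bar c$. Let $M_a=\max_i a_i$ and $M_b=\max_i b_i$. If $M_aM_b\le n\bar c+1$, then $\vec d$ is graphic with loops. In particular, if $\max_i a_i=\max_i b_i$ and $\max\vec d\le\lfloor\sqrt{n\bar c+1}\rfloor$, then $\vec d$ is graphic with loops.
   Context: A bidegree sequence of length $n$ is a pair $\vec d=(\vec a,\vec b)$ with $\vec a=(a_1,\dots,a_n)\in\mathbb{N}_0^n$ and $\vec b=(b_1,\dots,b_n)\in\mathbb{N}_0^n$. It is graphic with loops if there is an $n\times n$ matrix with entries in $\{0,1\}$ whose $i$th row sum is $a_i$ and whose $i$th column sum is $b_i$ for every $i\in[1..n]$; it is graphic if such a matrix exists with all diagonal entries equal to $0$. $\max\vec d$ and $\min\vec d$ denote the maximum and minimum over all $2n$ entries $a_1,\dots,a_n,b_1,\dots,b_n$. The number $\bar c$ (the average degree) is defined by $\sum_i a_i=\sum_i b_i=n\bar c$. -}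

module Defs where

import Algebra.Properties.CommutativeMonoid.Sum
open import Data.Fin.Base as Fin using (Fin; toℕ)
open import Data.Integer.Base as ℤ using (+_)
import Data.Integer.Properties as ℤ
open import Data.Nat.Base as ℕ using (ℕ; zero; suc; _⊔_)
import Data.Nat.Properties as ℕ
open import Data.Product.Base using (_×_; _,_; Σ-syntax)
open import Data.Rational.Base as ℚ using (ℚ; 0ℚ; ↥_)
open import Data.Rational.Literals using (fromℤ)
import Data.Rational.Properties as ℚ
open import Data.Vec.Functional using (Vector; foldr; map; transpose; _++_)
open import Relation.Binary.Core using (_Preserves_⟶_)
open import Relation.Binary.PropositionalEquality using (_≡_; subst; sym)
open import Relation.Nullary using (yes; no)

open Algebra.Properties.CommutativeMonoid.Sum ℕ.+-0-commutativeMonoid public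
  using (sum)

maximum : ∀ {n} → Vector ℕ n → ℕ
maximum = foldr _⊔_ 0

NonIncreasing : ∀ {n} → Vector ℕ n → Set
NonIncreasing a = a Preserves Fin._≤_ ⟶ ℕ._≥_

BidegreeSequence : ℕ → Set
BidegreeSequence n = Vector ℕ n × Vector ℕ n

maxDegree : ∀ {n} → BidegreeSequence n → ℕ
maxDegree (a , b) = maximum (a ++ b)

-- Given by rows: A i j is the entry in row i and column j.
Matrix01 : ℕ → Set
Matrix01 n = Vector (Vector (Fin 2) n) n

rowSum columnSum : ∀ {n} → Matrix01 n → Fin n → ℕ
rowSum    A i = sum (map toℕ (A i))
columnSum A i = sum (map toℕ (transpose A i))

GraphicWithLoops : ∀ {n} → BidegreeSequence n → Set
GraphicWithLoops {n} (a , b) =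
  Σ[ A ∈ Matrix01 n ] ∀ (i : Fin n) → rowSum A i ≡ a i × columnSum A i ≡ b i

fromℕ : ℕ → ℚ
fromℕ m = fromℤ (+ m)

-- The largest m ≤ k with m² ≤ x, or 0 if there is none.
floorSqrtUpTo : ℕ → ℚ → ℕ
floorSqrtUpTo zero    x = 0
floorSqrtUpTo (suc k) x with fromℕ (suc k ℕ.* suc k) ℚ.≤? x
... | yes _ = suc k
... | no  _ = floorSqrtUpTo k x

-- ⌊√ x ⌋ is the integer part of the real square root of x ≥ 0; see
-- ⌊√⌋-lower and ⌊√⌋-upper.  The search bound suffices because
-- m² ≤ x = p / q implies m ≤ p.
⌊√_⌋ : ℚ → ℕ
⌊√ x ⌋ = floorSqrtUpTo ℤ.∣ ↥ x ∣ x

⌊√⌋-lower : ∀ {x} → 0ℚ ℚ.≤ x → fromℕ (⌊√ x ⌋ ℕ.* ⌊√ x ⌋) ℚ.≤ x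
⌊√⌋-lower {x} 0≤x = go ℤ.∣ ↥ x ∣
  where
  go : ∀ k → fromℕ (floorSqrtUpTo k x ℕ.* floorSqrtUpTo k x) ℚ.≤ x
  go zero = 0≤x
  go (suc k) with fromℕ (suc k ℕ.* suc k) ℚ.≤? x
  ... | yes p = p
  ... | no  _ = go k

⌊√⌋-upper : ∀ x → x ℚ.< fromℕ (suc ⌊√ x ⌋ ℕ.* suc ⌊√ x ⌋)
⌊√⌋-upper x = go ℤ.∣ ↥ x ∣ (bound x)
  where
  bound : ∀ x → x ℚ.< fromℕ (suc ℤ.∣ ↥ x ∣ ℕ.* suc ℤ.∣ ↥ x ∣)
  bound (ℚ.mkℚ p d _) =
    ℚ.*<* (subst (ℤ._< + (s ℕ.* s) ℤ.* + suc d) (sym (ℤ.*-identityʳ p))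
      (ℤ.≤-<-trans (p≤∣p∣ p)
        (subst (+ ℤ.∣ p ∣ ℤ.<_) (ℤ.pos-* (s ℕ.* s) (suc d))
          (ℤ.+<+ (ℕ.≤-trans (ℕ.m≤m*n s s) (ℕ.m≤m*n (s ℕ.* s) (suc d)))))))
    where
    s = suc ℤ.∣ p ∣
    p≤∣p∣ : ∀ p → p ℤ.≤ + ℤ.∣ p ∣
    p≤∣p∣ (+ _)          = ℤ.≤-refl
    p≤∣p∣ ℤ.-[1+ _ ]   = ℤ.-≤+

  go : ∀ k → x ℚ.< fromℕ (suc k ℕ.* suc k) →
       x ℚ.< fromℕ (suc (floorSqrtUpTo k x) ℕ.* suc (floorSqrtUpTo k x))
  go zero    h = h
  go (suc k) h with fromℕ (suc k ℕ.* suc k) ℚ.≤? x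
  ... | yes _ = h
  ... | no ¬p = go k (ℚ.≰⇒> ¬p)

{-# OPTIONS --safe #-}

-- Start from the Ferrers matrix whose column j has its ones in the first b_j
-- rows.  Its first k rows contain Σ_j min(b_j, k) ones.  For k ≥ M_b this is the
-- whole sum S; for k < M_b the estimate M_b · min(b_j, k) ≥ k · b_j together with
-- S + 1 ≥ M_a M_b shows that it is at least k M_a.  So the row sums r of the
-- Ferrers matrix dominate a.  While r ≠ a, let i be the first row with r_i > a_i
-- and j the first later row with r_j < a_j: then r_i > a_i ≥ a_j > r_j, hence some
-- column has a one in row i and a zero in row j, and exchanging these moves r
-- towards a without changing column sums.
module Submission where

open import Defs
import Algebra.Properties.CommutativeMonoid.Sum
import Algebra.Properties.Semiring.Sum
open import Data.Fin.Base using (Fin; zero; suc; toℕ; _↑ˡ_; _↑ʳ_)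
import Data.Fin.Permutation as Permutation
open import Data.Fin.Permutation.Components using () renaming (transpose to transposition)
import Data.Fin.Properties as Fin
open import Data.Integer.Base as ℤ using (+_)
import Data.Integer.Properties as ℤ
open import Data.Nat.Base as ℕ
  using (ℕ; zero; suc; pred; _+_; _*_; _∸_; _⊓_; _≤_; _<_; z≤n; s≤s; s≤s⁻¹)
import Data.Nat.Properties as ℕ
open import Data.Nat.Tactic.RingSolver using (solve-∀)
open import Data.Product.Base using (_×_; _,_; ∃-syntax; proj₁; proj₂)
open import Data.Rational.Base as ℚ using (ℚ; 1ℚ)
import Data.Rational.Properties as ℚ
import Data.Rational.Unnormalised.Base as ℚᵘ
import Data.Rational.Unnormalised.Properties as ℚᵘ
open import Data.Sum.Base using (inj₁; inj₂)
open import Data.Vec.Base using (Vec; []; _∷_; tabulate; lookup; _[_]%=_)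
open import Data.Vec.Functional using (Vector; tail; map; updateAt; _++_)
open import Data.Vec.Functional.Properties
  using (updateAt-updates; updateAt-minimal; lookup-++ˡ; lookup-++ʳ)
open import Data.Vec.Properties using (lookup∘tabulate; lookup∘updateAt; lookup∘updateAt′)
open import Function.Base using (_∘_; const)
open import Relation.Binary.PropositionalEquality
  using (_≡_; _≢_; refl; sym; trans; cong; subst; subst₂; module ≡-Reasoning)
open import Relation.Nullary.Decidable using (dec-true; dec-false)
open import Relation.Nullary using (Dec; yes; no; contradiction)

private
  module Σ  = Algebra.Properties.CommutativeMonoid.Sum ℕ.+-0-commutativeMonoid
  module Σ* = Algebra.Properties.Semiring.Sum ℕ.+-*-semiring

  variable
    n : ℕ

-- Sums and maxima of finite vectors.

sum-mono-≤ : ∀ {s t : Vector ℕ n} → (∀ i → s i ≤ t i) → sum s ≤ sum t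
sum-mono-≤ {zero}  s≤t = z≤n
sum-mono-≤ {suc n} s≤t = ℕ.+-mono-≤ (s≤t zero) (sum-mono-≤ (s≤t ∘ suc))

lookup≤maximum : ∀ (t : Vector ℕ n) i → t i ≤ maximum t
lookup≤maximum t zero    = ℕ.m≤m⊔n _ _
lookup≤maximum t (suc i) = ℕ.≤-trans (lookup≤maximum (tail t) i) (ℕ.m≤n⊔m (t zero) _)

maximum-lub : ∀ {t : Vector ℕ n} {m} → (∀ i → t i ≤ m) → maximum t ≤ m
maximum-lub {zero}  t≤m = z≤n
maximum-lub {suc n} t≤m = ℕ.⊔-lub (t≤m zero) (maximum-lub (t≤m ∘ suc))

maximum≤sum : ∀ (t : Vector ℕ n) → maximum t ≤ sum t
maximum≤sum {zero}  t = z≤n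
maximum≤sum {suc n} t =
  ℕ.≤-trans (ℕ.⊔-mono-≤ ℕ.≤-refl (maximum≤sum (tail t))) (ℕ.m⊔n≤m+n (t zero) _)

sum≤n*bound : ∀ {t : Vector ℕ n} {m} → (∀ i → t i ≤ m) → sum t ≤ n * m
sum≤n*bound {zero}  t≤m = z≤n
sum≤n*bound {suc n} t≤m = ℕ.+-mono-≤ (t≤m zero) (sum≤n*bound (t≤m ∘ suc))

maximum-++ˡ : ∀ (s t : Vector ℕ n) → maximum s ≤ maximum (s ++ t)
maximum-++ˡ {n} s t = maximum-lub λ i →
  subst (_≤ maximum (s ++ t)) (lookup-++ˡ s t i) (lookup≤maximum (s ++ t) (i ↑ˡ n))

maximum-++ʳ : ∀ (s t : Vector ℕ n) → maximum t ≤ maximum (s ++ t)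
maximum-++ʳ {n} s t = maximum-lub λ i →
  subst (_≤ maximum (s ++ t)) (lookup-++ʳ s t i) (lookup≤maximum (s ++ t) (n ↑ʳ i))

-- Transfers between rows

-- Adding the replaced entry on the left keeps truncated subtraction out of the identity.
sum-updateAt : ∀ (u : Vector (Fin 2) n) c x →
  sum (map toℕ (updateAt u c (const x))) + toℕ (u c) ≡ sum (map toℕ u) + toℕ x
sum-updateAt {suc n} u zero x = swap (toℕ x) _ (toℕ (u zero))
  where
  swap : ∀ x s y → x + s + y ≡ y + s + x
  swap = solve-∀
sum-updateAt {suc n} u (suc c) x = begin
  toℕ (u zero) + s + toℕ (u (suc c))               ≡⟨ ℕ.+-assoc (toℕ (u zero)) s _ ⟩
  toℕ (u zero) + (s + toℕ (u (suc c)))             ≡⟨ cong (λ z → toℕ (u zero) + z) (sum-updateAt (tail u) c x) ⟩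
  toℕ (u zero) + (sum (map toℕ (tail u)) + toℕ x)  ≡⟨ ℕ.+-assoc (toℕ (u zero)) _ _ ⟨
  sum (map toℕ u) + toℕ x                          ∎
  where
  open ≡-Reasoning
  s = sum (map toℕ (updateAt (tail u) c (const x)))

sum-<⇒∃ : ∀ (u v : Vector (Fin 2) n) → sum (map toℕ u) < sum (map toℕ v) →
  ∃[ c ] u c ≡ zero × v c ≡ suc zero
sum-<⇒∃ {suc n} u v u<v with u zero in u₀ | v zero in v₀
... | zero     | suc zero = zero , u₀ , v₀
... | zero     | zero     = let c , p = sum-<⇒∃ (tail u) (tail v) u<v in suc c , p
... | suc zero | suc zero = let c , p = sum-<⇒∃ (tail u) (tail v) (s≤s⁻¹ u<v) in suc c , p
-- Here the head of `u` exceeds that of `v`, so the tails satisfy the inequality with room to spare.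
... | suc zero | zero     = let c , p = sum-<⇒∃ (tail u) (tail v) (ℕ.<⇒≤ u<v) in suc c , p

transposition-matchˡ : ∀ (i j : Fin n) → transposition i j i ≡ j
transposition-matchˡ i j rewrite dec-true (i Fin.≟ i) refl = refl

transposition-matchʳ : ∀ (i j : Fin n) → transposition i j j ≡ i
transposition-matchʳ i j with j Fin.≟ i
... | yes j≡i = j≡i
... | no  _ rewrite dec-true (j Fin.≟ j) refl = refl

transposition-mismatch : ∀ {i j k : Fin n} → k ≢ i → k ≢ j → transposition i j k ≡ k
transposition-mismatch {i = i} {j} {k} k≢i k≢j
  rewrite dec-false (k Fin.≟ i) k≢i | dec-false (k Fin.≟ j) k≢j = refl

-- Row sums live in a `Vec`, where entrywise equality gives equality without function extensionality
-- and updates reduce on `_∷_`. The strict inequality makes entry `i` positive, so `pred` really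
-- removes a unit.
TransferClosed : (Vec ℕ n → Set) → Set
TransferClosed P = ∀ r i j → lookup r j < lookup r i → P r → P (r [ i ]%= pred [ j ]%= suc)

graphic-transferClosed : (b : Vector ℕ n) → TransferClosed (λ r → GraphicWithLoops (lookup r , b))
graphic-transferClosed {n} b r i j rj<ri (A , sums) = A′ , λ x → rows x , columns x
  where
  open ≡-Reasoning

  found = sum-<⇒∃ (A j) (A i)
    (subst₂ _<_ (sym (proj₁ (sums j))) (sym (proj₁ (sums i))) rj<ri)

  c = proj₁ found
  Ajc≡0 = proj₁ (proj₂ found)
  Aic≡1 = proj₂ (proj₂ found)

  A′ : Matrix01 n
  -- Column `c` is permuted by the transposition of `i` and `j`, so its sum survives by
  -- `sum-permute`. Rows other than `i` and `j` get their own entry written back, so one formula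
  -- covers all rows.
  A′ x = updateAt (A x) c (const (A (transposition i j x) c))

  i≢j : i ≢ j
  i≢j refl = ℕ.<-irrefl refl rj<ri

  r′ = r [ i ]%= pred

  balance : ∀ x y → transposition i j x ≡ y →
            rowSum A′ x + toℕ (A x c) ≡ lookup r x + toℕ (A y c)
  balance x _ refl = trans (sum-updateAt (A x) c _) (cong (_+ toℕ (A (transposition i j x) c)) (proj₁ (sums x)))

  row-i : rowSum A′ i ≡ lookup (r′ [ j ]%= suc) i
  row-i = begin
    rowSum A′ i                  ≡⟨ cong pred (begin
      suc (rowSum A′ i)          ≡⟨ ℕ.+-comm 1 _ ⟩
      rowSum A′ i + 1            ≡⟨ cong (λ z → rowSum A′ i + toℕ z) Aic≡1 ⟨
      rowSum A′ i + toℕ (A i c)  ≡⟨ balance i j (transposition-matchˡ i j) ⟩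
      lookup r i + toℕ (A j c)   ≡⟨ cong (λ z → lookup r i + toℕ z) Ajc≡0 ⟩
      lookup r i + 0             ≡⟨ ℕ.+-identityʳ _ ⟩
      lookup r i                 ∎) ⟩
    pred (lookup r i)            ≡⟨ lookup∘updateAt i r ⟨
    lookup r′ i                  ≡⟨ lookup∘updateAt′ i j i≢j r′ ⟨
    lookup (r′ [ j ]%= suc) i    ∎

  row-j : rowSum A′ j ≡ lookup (r′ [ j ]%= suc) j
  row-j = begin
    rowSum A′ j                  ≡⟨ ℕ.+-identityʳ _ ⟨
    rowSum A′ j + 0              ≡⟨ cong (λ z → rowSum A′ j + toℕ z) Ajc≡0 ⟨
    rowSum A′ j + toℕ (A j c)    ≡⟨ balance j i (transposition-matchʳ i j) ⟩
    lookup r j + toℕ (A i c)     ≡⟨ cong (λ z → lookup r j + toℕ z) Aic≡1 ⟩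
    lookup r j + 1               ≡⟨ ℕ.+-comm _ 1 ⟩
    suc (lookup r j)             ≡⟨ cong suc (lookup∘updateAt′ j i (i≢j ∘ sym) r) ⟨
    suc (lookup r′ j)            ≡⟨ lookup∘updateAt j r′ ⟨
    lookup (r′ [ j ]%= suc) j    ∎

  row-other : ∀ {x} → x ≢ i → x ≢ j → rowSum A′ x ≡ lookup (r′ [ j ]%= suc) x
  row-other {x} x≢i x≢j = begin
    rowSum A′ x                  ≡⟨ ℕ.+-cancelʳ-≡ (toℕ (A x c)) _ _
                                      (balance x x (transposition-mismatch x≢i x≢j)) ⟩
    lookup r x                   ≡⟨ lookup∘updateAt′ x i x≢i r ⟨
    lookup r′ x                  ≡⟨ lookup∘updateAt′ x j x≢j r′ ⟨
    lookup (r′ [ j ]%= suc) x    ∎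

  rows : ∀ x → rowSum A′ x ≡ lookup (r′ [ j ]%= suc) x
  rows x = split (x Fin.≟ i) (x Fin.≟ j)
    where
    split : ∀ {x} → Dec (x ≡ i) → Dec (x ≡ j) → rowSum A′ x ≡ lookup (r′ [ j ]%= suc) x
    split (yes refl) _          = row-i
    split (no _)     (yes refl) = row-j
    split (no x≢i)   (no x≢j)   = row-other x≢i x≢j

  columns : ∀ y → columnSum A′ y ≡ b y
  columns y with y Fin.≟ c
  ... | no y≢c = trans
    (Σ.sum-cong-≗ λ x → cong toℕ (updateAt-minimal y c (A x) y≢c))
    (proj₂ (sums y))
  ... | yes refl = begin
    columnSum A′ c                              ≡⟨ Σ.sum-cong-≗ (λ x → cong toℕ (updateAt-updates c (A x))) ⟩
    sum (λ x → toℕ (A (transposition i j x) c)) ≡⟨ Σ.sum-permute (λ x → toℕ (A x c)) (Permutation.transpose i j) ⟨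
    columnSum A c                               ≡⟨ proj₂ (sums c) ⟩
    b c                                         ∎

-- Dominance and reachability by transfers.

-- The index is the excess of r over a accumulated in the rows already passed;
-- Dominates 0 a r says that r dominates a and has the same sum.
data Dominates : ∀ {n} → ℕ → Vector ℕ n → Vec ℕ n → Set where
  []  : ∀ {a} → Dominates 0 a []
  _∷_ : ∀ {n e e′ x} {a : Vector ℕ (suc n)} {r : Vec ℕ n} →
        e + x ≡ e′ + a zero → Dominates e′ (tail a) r → Dominates e a (x ∷ r)

-- The excess must fall to 0 by the end, so some entry lies below `a`. Raising the first such entry
-- by one makes up for one unit less of incoming excess.
absorb : ∀ {e} {a : Vector ℕ n} {r} → Dominates (suc e) a r →
  ∃[ j ] lookup r j < a j × Dominates e a (r [ j ]%= suc)
absorb {e = e} {a} (_∷_ {e′ = e′} {x} eq d) with x ℕ.<? a zero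
... | yes x<a = zero , x<a , trans (ℕ.+-suc e x) eq ∷ d
... | no  x≮a with e′
-- When `x` is at least `a zero`, a positive incoming excess stays positive past this row.
...   | zero  = contradiction
        (ℕ.≤-trans (s≤s (ℕ.m≤n+m x e)) (ℕ.≤-reflexive eq)) x≮a
...   | suc _ = let j , r<a , d′ = absorb d in suc j , r<a , ℕ.suc-injective eq ∷ d′

-- Rows are settled from the top: `descend` hands the excess of the first row, unit by unit, to the
-- later rows found by `absorb`. `P` is general so that the recursion can carry the settled entry as
-- `P ∘ (a zero ∷_)`.
dominates⇒reachable : ∀ {P : Vec ℕ n → Set} {a r} → TransferClosed P → NonIncreasing a →
  Dominates 0 a r → P r → P (tabulate a)
dominates⇒reachable {zero} {r = []} closed mono [] p = p
dominates⇒reachable {suc n} {P} {a} {x ∷ r} closed mono (eq ∷ d) p =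
  descend _ d (subst (λ x → P (x ∷ r)) eq p)
  where
  descend : ∀ e {r} → Dominates e (tail a) r → P (e + a zero ∷ r) → P (tabulate a)
  descend zero d p = dominates⇒reachable {P = P ∘ (a zero ∷_)}
    (λ r i j → closed (a zero ∷ r) (suc i) (suc j)) (mono ∘ s≤s) d p
  descend (suc e) d p = let j , r<a , d′ = absorb d in
    -- Monotonicity of `a` makes the transfer legal: the receiving entry is below its target, which
    -- is at most `a zero`, and the giving entry is `suc e + a zero`.
    descend e d′ (closed _ zero (suc j)
      (s≤s (ℕ.≤-trans (ℕ.<⇒≤ r<a) (ℕ.≤-trans (mono z≤n) (ℕ.m≤n+m _ e)))) p)

-- c is the sum of the entries of a that have already been passed.
prefixSums⇒dominates : ∀ {m} (a : Vector ℕ n) (D r : ℕ → ℕ) {c e} →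
  (∀ i → a i ≤ m) →
  (∀ k → D k + r k ≡ D (suc k)) →
  (∀ k → D k ≤ c + sum a) →
  (∀ k → (c + k * m) ⊓ (c + sum a) ≤ D k) →
  e + c ≡ D 0 →
  Dominates e a (tabulate (r ∘ toℕ))
prefixSums⇒dominates {zero} a D r {c} {e} a≤m step D≤ ≤D eq =
  subst (λ e → Dominates e a []) (sym e≡0) []
  where
  e≡0 : e ≡ 0
  e≡0 = ℕ.n≤0⇒n≡0 (ℕ.+-cancelˡ-≤ c e 0
    (subst (_≤ c + 0) (trans (sym eq) (ℕ.+-comm e c)) (D≤ 0)))
prefixSums⇒dominates {suc n} {m} a D r {c} {e} a≤m step D≤ ≤D eq =
  excess ∷ prefixSums⇒dominates (tail a) (D ∘ suc) (r ∘ suc) (a≤m ∘ suc) (step ∘ suc)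
    (λ k → subst (D (suc k) ≤_) c+sum (D≤ (suc k)))
    ≤D′
    e′+c′
  where
  c′ = c + a zero
  -- The subtraction is exact: `≤D′` at 0 gives `c′ ≤ D 1`.
  e′ = D 1 ∸ c′

  c+sum : c + sum a ≡ c′ + sum (tail a)
  c+sum = sym (ℕ.+-assoc c _ _)

  -- Trading one of the `suc k` copies of `m` for `a zero` can only lower the bound, so it passes to
  -- the tail.
  ≤D′ : ∀ k → (c′ + k * m) ⊓ (c′ + sum (tail a)) ≤ D (suc k)
  ≤D′ k = ℕ.≤-trans
    (ℕ.⊓-mono-≤
      (ℕ.≤-trans (ℕ.≤-reflexive (ℕ.+-assoc c _ _))
        (ℕ.+-monoʳ-≤ c (ℕ.+-monoˡ-≤ (k * m) (a≤m zero))))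
      (ℕ.≤-reflexive (sym c+sum)))
    (≤D (suc k))

  e′+c′ : e′ + c′ ≡ D 1
  e′+c′ = ℕ.m∸n+n≡m (ℕ.≤-trans (ℕ.⊓-glb (ℕ.m≤m+n c′ 0) (ℕ.m≤m+n c′ _)) (≤D′ 0))

  excess : e + r 0 ≡ e′ + a zero
  excess = ℕ.+-cancelʳ-≡ c _ _ (begin
    e + r 0 + c        ≡⟨ shuffle e (r 0) c ⟩
    e + c + r 0        ≡⟨ cong (_+ r 0) eq ⟩
    D 0 + r 0          ≡⟨ step 0 ⟩
    D 1                ≡⟨ e′+c′ ⟨
    e′ + (c + a zero)  ≡⟨ shuffle′ e′ c (a zero) ⟩
    e′ + a zero + c    ∎)
    where
    open ≡-Reasoning
    shuffle : ∀ x y z → x + y + z ≡ x + z + y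
    shuffle = solve-∀
    shuffle′ : ∀ x y z → x + (y + z) ≡ x + z + y
    shuffle′ = solve-∀

-- The Ferrers matrix

-- The indicator of `i < b`, by the same recursion as `_⊓_`, whose increments it gives.
ferrersEntry : ℕ → ℕ → Fin 2
ferrersEntry i       zero    = zero
ferrersEntry zero    (suc b) = suc zero
ferrersEntry (suc i) (suc b) = ferrersEntry i b

ferrers : Vector ℕ n → Matrix01 n
ferrers b i j = ferrersEntry (toℕ i) (b j)

⊓-ferrersEntry : ∀ k b → b ⊓ k + toℕ (ferrersEntry k b) ≡ b ⊓ suc k
⊓-ferrersEntry k       zero    = refl
⊓-ferrersEntry zero    (suc b) = cong suc (sym (ℕ.⊓-zeroʳ b))
⊓-ferrersEntry (suc k) (suc b) = cong suc (⊓-ferrersEntry k b)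

sum-ferrersEntry : ∀ {b} → b ≤ n → sum {n} (λ i → toℕ (ferrersEntry (toℕ i) b)) ≡ b
sum-ferrersEntry {n}     z≤n       = Σ.sum-replicate-zero n
sum-ferrersEntry {suc n} (s≤s b≤n) = cong suc (sum-ferrersEntry b≤n)

-- The product `k * b` is the larger factor times `b ⊓ k`, and the larger factor is at most `m`.
*-⊓-≥ : ∀ {m b} k → b ≤ m → k ≤ m → k * b ≤ m * (b ⊓ k)
*-⊓-≥ {m} {b} k b≤m k≤m with ℕ.≤-total b k
... | inj₁ b≤k rewrite ℕ.m≤n⇒m⊓n≡m b≤k = ℕ.*-monoˡ-≤ b k≤m
... | inj₂ k≤b rewrite ℕ.m≥n⇒m⊓n≡n k≤b | ℕ.*-comm k b = ℕ.*-monoˡ-≤ k b≤m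

module _ (b : Vector ℕ n) where

  ferrersPrefix : ℕ → ℕ
  ferrersPrefix k = sum (λ j → b j ⊓ k)

  ferrersRow : ℕ → ℕ
  ferrersRow k = sum (λ j → toℕ (ferrersEntry k (b j)))

  ferrersPrefix-step : ∀ k → ferrersPrefix k + ferrersRow k ≡ ferrersPrefix (suc k)
  ferrersPrefix-step k = trans (sym (Σ.∑-distrib-+ (λ j → b j ⊓ k) _))
    (Σ.sum-cong-≗ λ j → ⊓-ferrersEntry k (b j))

  ferrersPrefix-≥ : ∀ {m} → m * maximum b ≤ suc (sum b) →
    ∀ k → (k * m) ⊓ sum b ≤ ferrersPrefix k
  ferrersPrefix-≥ {m} small k with ℕ.<-≤-connex k (maximum b)
  ... | inj₂ M≤k = ℕ.≤-trans (ℕ.m⊓n≤n (k * m) _) (ℕ.≤-reflexive (Σ.sum-cong-≗ λ j →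
          sym (ℕ.m≤n⇒m⊓n≡m (ℕ.≤-trans (lookup≤maximum b j) M≤k))))
  -- Multiplying by `M` avoids division. The extra unit in `small` costs only `k < M`, which is lost
  -- on cancelling `M` from the strict inequality.
  ... | inj₁ k<M = ℕ.≤-trans (ℕ.m⊓n≤m _ (sum b)) (s≤s⁻¹ (ℕ.*-cancelˡ-< M _ _ (begin-strict
    M * (k * m)                           ≡⟨ shuffle M k m ⟩
    k * (m * M)                           ≤⟨ ℕ.*-monoʳ-≤ k small ⟩
    k * suc (sum b)                       ≡⟨ ℕ.*-suc k _ ⟩
    k + k * sum b                         <⟨ ℕ.+-monoˡ-< _ k<M ⟩
    M + k * sum b                         ≡⟨ cong (λ z → M + z) (Σ*.*-distribˡ-sum k b) ⟩
    M + sum (map (k *_) b)                ≤⟨ ℕ.+-monoʳ-≤ M (sum-mono-≤ λ j →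
                                               *-⊓-≥ k (lookup≤maximum b j) (ℕ.<⇒≤ k<M)) ⟩
    M + sum (λ j → M * (b j ⊓ k))         ≡⟨ cong (λ z → M + z) (Σ*.*-distribˡ-sum M (λ j → b j ⊓ k)) ⟨
    M + M * ferrersPrefix k               ≡⟨ ℕ.*-suc M _ ⟨
    M * suc (ferrersPrefix k)             ∎)))
    where
    open ℕ.≤-Reasoning
    M = maximum b
    shuffle : ∀ x y z → x * (y * z) ≡ y * (z * x)
    shuffle = solve-∀

-- Ensures that the Ferrers columns fit into `n` rows. If `maximum b` exceeded `n`, then `small` and
-- `sum b ≤ n * m` would force `m ≤ 1`, hence `maximum b ≤ sum b ≤ n`.
maximum≤length : ∀ (a b : Vector ℕ n) → sum a ≡ sum b →
  maximum a * maximum b ≤ suc (sum b) → maximum b ≤ n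
maximum≤length {n} a b Σa≡Σb small with ℕ.≤-<-connex (maximum b) n
... | inj₁ M≤n = M≤n
... | inj₂ n<M = ℕ.≤-trans (maximum≤sum b) (ℕ.≤-trans Σb≤nm
        (ℕ.≤-trans (ℕ.*-monoʳ-≤ n m≤1) (ℕ.≤-reflexive (ℕ.*-identityʳ n))))
  where
  m = maximum a

  Σb≤nm : sum b ≤ n * m
  Σb≤nm = subst (_≤ n * m) Σa≡Σb (sum≤n*bound (lookup≤maximum a))

  m≤1 : m ≤ 1
  m≤1 = ℕ.+-cancelʳ-≤ (n * m) m 1 (begin
    suc n * m      ≤⟨ ℕ.*-monoˡ-≤ m n<M ⟩
    maximum b * m  ≡⟨ ℕ.*-comm _ m ⟩
    m * maximum b  ≤⟨ small ⟩
    suc (sum b)    ≤⟨ s≤s Σb≤nm ⟩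
    suc (n * m)    ∎)
    where open ℕ.≤-Reasoning

graphicWithLoops : ∀ (a b : Vector ℕ n) → NonIncreasing a → sum a ≡ sum b →
  maximum a * maximum b ≤ suc (sum b) → GraphicWithLoops (a , b)
graphicWithLoops {n} a b mono Σa≡Σb small =
  let A , sums = dominates⇒reachable (graphic-transferClosed b) mono dominates initial
  in  A , λ i → trans (proj₁ (sums i)) (lookup∘tabulate a i) , proj₂ (sums i)
  where
  dominates : Dominates 0 a (tabulate (ferrersRow b ∘ toℕ))
  dominates = prefixSums⇒dominates a (ferrersPrefix b) (ferrersRow b)
    (lookup≤maximum a)
    (ferrersPrefix-step b)
    (λ k → subst (ferrersPrefix b k ≤_) (sym Σa≡Σb) (sum-mono-≤ λ j → ℕ.m⊓n≤m (b j) k))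
    (λ k → subst (λ s → (k * maximum a) ⊓ s ≤ ferrersPrefix b k) (sym Σa≡Σb)
             (ferrersPrefix-≥ b small k))
    (sym (trans (Σ.sum-cong-≗ λ j → ℕ.⊓-zeroʳ (b j)) (Σ.sum-replicate-zero n)))

  initial : GraphicWithLoops (lookup (tabulate (ferrersRow b ∘ toℕ)) , b)
  initial = ferrers b , λ i →
    sym (lookup∘tabulate _ i) ,
    sum-ferrersEntry (ℕ.≤-trans (lookup≤maximum b i) (maximum≤length a b Σa≡Σb small))

-- From rational to natural inequalities.

fromℕ-suc : ∀ m → fromℕ m ℚ.+ 1ℚ ≡ fromℕ (suc m)
fromℕ-suc m = ℚ.toℚᵘ-injective (ℚᵘ.≃-trans (ℚ.toℚᵘ-homo-+ (fromℕ m) 1ℚ)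
  (ℚᵘ.*≡* (cong (ℤ._* + 1)
    (trans (cong (ℤ._+ + 1) (ℤ.*-identityʳ (+ m))) (cong +_ (ℕ.+-comm m 1))))))

fromℕ-cancel-≤ : ∀ {l m} → fromℕ l ℚ.≤ fromℕ m → l ≤ m
fromℕ-cancel-≤ (ℚ.*≤* l≤m) =
  ℤ.drop‿+≤+ (subst₂ ℤ._≤_ (ℤ.*-identityʳ _) (ℤ.*-identityʳ _) l≤m)

fromℕ-nonNegative : ∀ m → ℚ.0ℚ ℚ.≤ fromℕ m
fromℕ-nonNegative m = ℚ.*≤* (subst (ℤ.0ℤ ℤ.≤_) (sym (ℤ.*-identityʳ (+ m))) (ℤ.+≤+ z≤n))

theorem3 : ∀ (n : ℕ) (a b : Vector ℕ n) (c̄ : ℚ) →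
    NonIncreasing a →
    fromℕ (sum a) ≡ fromℕ n ℚ.* c̄ →
    fromℕ (sum b) ≡ fromℕ n ℚ.* c̄ →
    (fromℕ (maximum a ℕ.* maximum b) ℚ.≤ fromℕ n ℚ.* c̄ ℚ.+ 1ℚ →
    GraphicWithLoops (a , b))
    ×
    (maximum a ≡ maximum b →
    maxDegree (a , b) ℕ.≤ ⌊√ fromℕ n ℚ.* c̄ ℚ.+ 1ℚ ⌋ →
    GraphicWithLoops (a , b))
-- The rewrites turn the bound into `fromℕ (suc (sum b))`, so both hypotheses descend to `ℕ`.
theorem3 n a b c̄ mono Σa≡nc̄ Σb≡nc̄ rewrite sym Σb≡nc̄ | fromℕ-suc (sum b) =
  (λ small → graphicWithLoops a b mono Σa≡Σb (fromℕ-cancel-≤ small)) ,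
  (λ _ max≤√ → graphicWithLoops a b mono Σa≡Σb
    (ℕ.≤-trans
      -- Both maxima are at most the integer square root, so their product is at most its square.
      (ℕ.*-mono-≤ (ℕ.≤-trans (maximum-++ˡ a b) max≤√) (ℕ.≤-trans (maximum-++ʳ a b) max≤√))
      (fromℕ-cancel-≤ (⌊√⌋-lower (fromℕ-nonNegative (suc (sum b)))))))
  where
  Σa≡Σb : sum a ≡ sum b
  Σa≡Σb = cong (ℤ.∣_∣ ∘ ℚ.↥_) Σa≡nc̄
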